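{- Let $G$ be a finite abelian group with $|G|\ge4$, $\sigma$ an automorphism of $G$ of order two, and $S$ a symmetric subset of $G$ of size $d$. Let $X$ be one of the Cayley sum graph $C_\Sigma(G,S)$, the twisted Cayley graph $C(G,S)^\sigma$, or the twisted Cayley sum graph $C_\Sigma(G,S)^\sigma$, and suppose $X$ is undirected. Then the diameter of $X$ is at least $\frac{|S|}{4e}|G|^{1/|S|}-\frac12|S|$.
   Context: $C_\Sigma(G,S)$ has vertex set $G$ and an edge from $x$ to $x^{ -1}s$ for each $s\in S$; $C(G,S)^\sigma$ has an edge from $x$ to $\sigma(xs)$; $C_\Sigma(G,S)^\sigma$ has an edge from $x$ to $\sigma(x^{ -1}s)$. A graph is undirected if its adjacency matrix is symmetric. The diameter is the supremum over pairs of vertices of the length of a shortest path between them (infinite if the graph is disconnected). -}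

module Defs where

open import Algebra.Bundles using (AbelianGroup)
open import Algebra.Morphism.Structures using (module GroupMorphisms)
open import Data.Empty using (⊥-elim)
open import Data.Fin.Base using (Fin)
import Data.Fin.Properties as Fin
open import Data.Integer.Base as ℤ using (+_; -[1+_]; +[1+_]; +<+; +≤+)
import Data.Integer.Properties as ℤ
open import Data.Integer.Solver using () renaming (module +-*-Solver to ℤ-Solver)
open import Data.List.Base using (length; filter; allFin)
open import Data.List.Properties using (filter-≐)
open import Data.Nat.Base as ℕ using (ℕ; zero; suc; _!; z≤n; s≤s; z<s)
import Data.Nat.Properties as ℕ
open import Data.Product.Base using (∃-syntax; _×_; _,_; proj₁; proj₂)
open import Data.Rational.Base as ℚ using (ℚ; mkℚ; 0ℚ; 1ℚ; ½; ∣_∣)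
import Data.Rational.Properties as ℚ
open import Data.Rational.Solver using (module +-*-Solver)
import Data.Rational.Unnormalised.Base as ℚᵘ
import Data.Rational.Unnormalised.Properties as ℚᵘ
open import Data.Sum.Base using (inj₁; inj₂)
open import Function.Bundles using (Injection; Inverse)
open import Function.Properties.Inverse using (Inverse⇒Injection)
open import Level using (Level; _⊔_)
open import Relation.Binary.Bundles using (Setoid)
import Relation.Binary.Construct.Add.Supremum.NonStrict as AddSupremum
open import Relation.Binary.Definitions using (Decidable)
open import Relation.Binary.PropositionalEquality.Core
  using (_≡_; refl; sym; trans; cong; cong₂; subst; subst₂)
import Relation.Binary.PropositionalEquality.Properties as ≡
open import Relation.Nullary.Construct.Add.Supremum using (_⁺; [_]; ⊤⁺)
open import Relation.Nullary.Decidable using (via-injection)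
open import Relation.Nullary.Decidable.Core using (yes; no)
open import Relation.Nullary.Negation.Core using (¬_)

∣-∣-near : ∀ {p q ε} → p ℚ.< q ℚ.+ ε → q ℚ.< p ℚ.+ ε → ∣ p ℚ.- q ∣ ℚ.< ε
∣-∣-near {p} {q} {ε} p<q+ε q<p+ε with ℚ.∣p∣≡p∨∣p∣≡-p (p ℚ.- q)
... | inj₁ eq = subst₂ ℚ._<_ (sym eq)
  (solve 2 (λ q ε → (q :+ ε) :+ (:- q) := ε) refl q ε)
  (ℚ.+-monoˡ-< (ℚ.- q) p<q+ε)
  where open +-*-Solver
... | inj₂ eq = subst₂ ℚ._<_
  (trans (solve 2 (λ p q → q :+ (:- p) := :- (p :+ (:- q))) refl p q) (sym eq))
  (solve 2 (λ p ε → (p :+ ε) :+ (:- p) := ε) refl p ε)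
  (ℚ.+-monoˡ-< (ℚ.- p) q<p+ε)
  where open +-*-Solver

/-mono-< : ∀ m p n q .{{_ : ℕ.NonZero p}} .{{_ : ℕ.NonZero q}} →
           m ℕ.* q ℕ.< n ℕ.* p → + m ℚ./ p ℚ.< + n ℚ./ q
/-mono-< m (suc p) n (suc q) lt = ℚ.toℚᵘ-cancel-<
  (ℚᵘ.<-respˡ-≃ (ℚᵘ.≃-sym (ℚ.toℚᵘ-fromℚᵘ (ℚᵘ.mkℚᵘ (+ m) p)))
  (ℚᵘ.<-respʳ-≃ (ℚᵘ.≃-sym (ℚ.toℚᵘ-fromℚᵘ (ℚᵘ.mkℚᵘ (+ n) q)))
    (ℚᵘ.*<* (subst₂ ℤ._<_ (ℤ.pos-* m (suc q)) (ℤ.pos-* n (suc p)) (+<+ lt)))))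

/-mono-≤ : ∀ m p n q .{{_ : ℕ.NonZero p}} .{{_ : ℕ.NonZero q}} →
           m ℕ.* q ℕ.≤ n ℕ.* p → + m ℚ./ p ℚ.≤ + n ℚ./ q
/-mono-≤ m (suc p) n (suc q) le = ℚ.toℚᵘ-cancel-≤
  (ℚᵘ.≤-respˡ-≃ (ℚᵘ.≃-sym (ℚ.toℚᵘ-fromℚᵘ (ℚᵘ.mkℚᵘ (+ m) p)))
  (ℚᵘ.≤-respʳ-≃ (ℚᵘ.≃-sym (ℚ.toℚᵘ-fromℚᵘ (ℚᵘ.mkℚᵘ (+ n) q)))
    (ℚᵘ.*≤* (subst₂ ℤ._≤_ (ℤ.pos-* m (suc q)) (ℤ.pos-* n (suc p)) (+≤+ le)))))

/-distrib-+ : ∀ m n p .{{_ : ℕ.NonZero p}} →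
              + (m ℕ.+ n) ℚ./ p ≡ + m ℚ./ p ℚ.+ + n ℚ./ p
/-distrib-+ m n (suc p) = ℚ.toℚᵘ-injective (begin
  ℚ.toℚᵘ (+ (m ℕ.+ n) ℚ./ suc p)
    ≈⟨ ℚ.toℚᵘ-fromℚᵘ (ℚᵘ.mkℚᵘ (+ (m ℕ.+ n)) p) ⟩
  ℚᵘ.mkℚᵘ (+ (m ℕ.+ n)) p
    ≈⟨ ℚᵘ.*≡* (trans (cong (ℤ._* (d ℤ.* d)) (ℤ.pos-+ m n))
         (distr (+ m) (+ n) d)) ⟩
  ℚᵘ.mkℚᵘ (+ m) p ℚᵘ.+ ℚᵘ.mkℚᵘ (+ n) p
    ≈⟨ ℚᵘ.+-cong (ℚ.toℚᵘ-fromℚᵘ (ℚᵘ.mkℚᵘ (+ m) p)) (ℚ.toℚᵘ-fromℚᵘ (ℚᵘ.mkℚᵘ (+ n) p)) ⟨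
  ℚ.toℚᵘ (+ m ℚ./ suc p) ℚᵘ.+ ℚ.toℚᵘ (+ n ℚ./ suc p)
    ≈⟨ ℚ.toℚᵘ-homo-+ (+ m ℚ./ suc p) (+ n ℚ./ suc p) ⟨
  ℚ.toℚᵘ (+ m ℚ./ suc p ℚ.+ + n ℚ./ suc p) ∎)
  where
  open import Relation.Binary.Reasoning.Setoid ℚᵘ.≃-setoid
  d = + suc p
  distr : ∀ a b d → (a ℤ.+ b) ℤ.* (d ℤ.* d) ≡ (a ℤ.* d ℤ.+ b ℤ.* d) ℤ.* d
  distr = S.solve 3 (λ a b d → (a S.:+ b) S.:* (d S.:* d)
                         S.:= (a S.:* d S.:+ b S.:* d) S.:* d) refl
    where module S = ℤ-Solver

archimedean : ∀ {ε} → 0ℚ ℚ.< ε → ∃[ N ] ∀ {n} → N ℕ.≤ n → + 1 ℚ./ suc n ℚ.< ε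
archimedean {mkℚ +[1+ p ] q c} _ = suc q , λ {n} q<n →
  subst (+ 1 ℚ./ suc n ℚ.<_) (ℚ.fromℚᵘ-toℚᵘ (mkℚ +[1+ p ] q c))
    (/-mono-< 1 (suc n) (suc p) (suc q) (begin-strict
      1 ℕ.* suc q         ≡⟨ ℕ.*-identityˡ (suc q) ⟩
      suc q               <⟨ s≤s q<n ⟩
      suc n               ≤⟨ ℕ.m≤n*m (suc n) (suc p) ⟩
      suc p ℕ.* suc n     ∎))
  where open ℕ.≤-Reasoning
archimedean {mkℚ (+ zero) _ _} (ℚ.*<* (+<+ ()))
archimedean {mkℚ -[1+ _ ] _ _} (ℚ.*<* ())

*-pos : ∀ {p q} → 0ℚ ℚ.< p → 0ℚ ℚ.< q → 0ℚ ℚ.< p ℚ.* q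
*-pos {p} {q} 0<p 0<q = subst (ℚ._< p ℚ.* q) (ℚ.*-zeroʳ p)
  (ℚ.*-monoʳ-<-pos p {{ℚ.positive 0<p}} 0<q)

*-mono-≤ : ∀ {p q r s} → 0ℚ ℚ.≤ p → 0ℚ ℚ.≤ s → p ℚ.≤ q → r ℚ.≤ s → p ℚ.* r ℚ.≤ q ℚ.* s
*-mono-≤ {p} {q} {r} {s} 0≤p 0≤s p≤q r≤s = ℚ.≤-trans
  (ℚ.*-monoˡ-≤-nonNeg p {{ℚ.nonNegative 0≤p}} r≤s)
  (ℚ.*-monoʳ-≤-nonNeg s {{ℚ.nonNegative 0≤s}} p≤q)

0<½ : 0ℚ ℚ.< ½
0<½ = ℚ.positive⁻¹ ½

0<1 : 0ℚ ℚ.< 1ℚ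
0<1 = ℚ.positive⁻¹ 1ℚ

0≤1 : 0ℚ ℚ.≤ 1ℚ
0≤1 = ℚ.<⇒≤ 0<1

halves : ∀ p → ½ ℚ.* p ℚ.+ ½ ℚ.* p ≡ p
halves p = trans (sym (ℚ.*-distribʳ-+ p ½ ½)) (ℚ.*-identityˡ p)

divide-into : ∀ {C p} → 0ℚ ℚ.< C → 0ℚ ℚ.< p → ∃[ q ] 0ℚ ℚ.< q × C ℚ.* q ≡ p
divide-into {C} {p} 0<C 0<p =
  ℚ.1/ C ℚ.* p ,
  *-pos (ℚ.positive⁻¹ (ℚ.1/ C) {{ℚ.1/pos⇒pos C}}) 0<p ,
  trans (sym (ℚ.*-assoc C (ℚ.1/ C) p))
    (trans (cong (ℚ._* p) (ℚ.*-inverseʳ C)) (ℚ.*-identityˡ p))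
  where
  instance
    C-pos = ℚ.positive 0<C
    C≢0   = ℚ.pos⇒nonZero C

difference-+ : ∀ a b c d → (a ℚ.+ b) ℚ.- (c ℚ.+ d) ≡ (a ℚ.- c) ℚ.+ (b ℚ.- d)
difference-+ = solve 4 (λ a b c d →
  (a :+ b) :+ (:- (c :+ d)) := (a :+ (:- c)) :+ (b :+ (:- d))) refl
  where open +-*-Solver

difference-* : ∀ a b c d → a ℚ.* b ℚ.- c ℚ.* d ≡ a ℚ.* (b ℚ.- d) ℚ.+ d ℚ.* (a ℚ.- c)
difference-* = solve 4 (λ a b c d →
  a :* b :+ (:- (c :* d)) := a :* (b :+ (:- d)) :+ d :* (a :+ (:- c))) refl
  where open +-*-Solver

∣-∣-difference-* : ∀ a b c d {A B εᴬ εᴮ} → 0ℚ ℚ.< A → 0ℚ ℚ.< B →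
  ∣ a ∣ ℚ.≤ A → ∣ d ∣ ℚ.≤ B → ∣ a ℚ.- c ∣ ℚ.< εᴮ → ∣ b ℚ.- d ∣ ℚ.< εᴬ →
  ∣ a ℚ.* b ℚ.- c ℚ.* d ∣ ℚ.< A ℚ.* εᴬ ℚ.+ B ℚ.* εᴮ
∣-∣-difference-* a b c d {A} {B} {εᴬ} {εᴮ} 0<A 0<B a≤A d≤B a-c<εᴮ b-d<εᴬ = begin-strict
  ∣ a ℚ.* b ℚ.- c ℚ.* d ∣
    ≡⟨ cong ∣_∣ (difference-* a b c d) ⟩
  ∣ a ℚ.* (b ℚ.- d) ℚ.+ d ℚ.* (a ℚ.- c) ∣
    ≤⟨ ℚ.∣p+q∣≤∣p∣+∣q∣ (a ℚ.* (b ℚ.- d)) (d ℚ.* (a ℚ.- c)) ⟩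
  ∣ a ℚ.* (b ℚ.- d) ∣ ℚ.+ ∣ d ℚ.* (a ℚ.- c) ∣
    ≡⟨ cong₂ ℚ._+_ (ℚ.∣p*q∣≡∣p∣*∣q∣ a (b ℚ.- d)) (ℚ.∣p*q∣≡∣p∣*∣q∣ d (a ℚ.- c)) ⟩
  ∣ a ∣ ℚ.* ∣ b ℚ.- d ∣ ℚ.+ ∣ d ∣ ℚ.* ∣ a ℚ.- c ∣
    ≤⟨ ℚ.+-mono-≤
         (ℚ.*-monoʳ-≤-nonNeg ∣ b ℚ.- d ∣ {{ℚ.∣-∣-nonNeg (b ℚ.- d)}} a≤A)
         (ℚ.*-monoʳ-≤-nonNeg ∣ a ℚ.- c ∣ {{ℚ.∣-∣-nonNeg (a ℚ.- c)}} d≤B) ⟩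
  A ℚ.* ∣ b ℚ.- d ∣ ℚ.+ B ℚ.* ∣ a ℚ.- c ∣
    <⟨ ℚ.+-mono-<
         (ℚ.*-monoʳ-<-pos A {{ℚ.positive 0<A}} b-d<εᴬ)
         (ℚ.*-monoʳ-<-pos B {{ℚ.positive 0<B}} a-c<εᴮ) ⟩
  A ℚ.* εᴬ ℚ.+ B ℚ.* εᴮ ∎
  where open ℚ.≤-Reasoning

difference-⁻¹ : ∀ a b a⁻¹ b⁻¹ →
  (a⁻¹ ℚ.- b⁻¹) ℚ.* (a ℚ.* b) ≡ (a ℚ.* a⁻¹) ℚ.* b ℚ.- (b ℚ.* b⁻¹) ℚ.* a
difference-⁻¹ = solve 4 (λ a b a⁻¹ b⁻¹ →
  (a⁻¹ :+ (:- b⁻¹)) :* (a :* b) := (a :* a⁻¹) :* b :+ (:- ((b :* b⁻¹) :* a))) refl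
  where open +-*-Solver

-- 1/p, extended by 1/0 = 0.
reciprocal : ℚ → ℚ
reciprocal p with p ℚ.≟ 0ℚ
... | yes _  = 0ℚ
... | no p≢0 = (ℚ.1/ p) {{ℚ.≢-nonZero p≢0}}

*-reciprocal : ∀ {p} → 0ℚ ℚ.< ∣ p ∣ → p ℚ.* reciprocal p ≡ 1ℚ
*-reciprocal {p} 0<∣p∣ with p ℚ.≟ 0ℚ
... | yes p≡0 = ⊥-elim (ℚ.<-irrefl refl (subst (λ q → 0ℚ ℚ.< ∣ q ∣) p≡0 0<∣p∣))
... | no p≢0  = ℚ.*-inverseʳ p {{ℚ.≢-nonZero p≢0}}

-- A real number is a Cauchy sequence of rationals together with a
-- modulus of convergence; different sequences may represent the same
-- number.
IsCauchy : (ℕ → ℚ) → Set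
IsCauchy x = ∀ {ε} → 0ℚ ℚ.< ε → ∃[ N ] ∀ {m n} → N ℕ.≤ m → N ℕ.≤ n → ∣ x m ℚ.- x n ∣ ℚ.< ε

record ℝ : Set where
  constructor mkℝ
  field
    seq      : ℕ → ℚ
    isCauchy : IsCauchy seq

open ℝ public

infix  4 _≤_
infixl 6 _+_ _-_
infixl 7 _*_ _÷_
infix  8 -_

_≤_ : ℝ → ℝ → Set
x ≤ y = ∀ {ε} → 0ℚ ℚ.< ε → ∃[ N ] ∀ {n} → N ℕ.≤ n → seq x n ℚ.≤ seq y n ℚ.+ ε

-- Being apart from zero, the constructive condition for invertibility.
record NonZero (x : ℝ) : Set where
  field
    bound     : ℚ
    bound-pos : 0ℚ ℚ.< bound
    index     : ℕ
    bounded   : ∀ {n} → index ℕ.≤ n → bound ℚ.≤ ∣ seq x n ∣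

fromℚ : ℚ → ℝ
fromℚ q = mkℝ (λ _ → q) λ 0<ε → 0 , λ _ _ →
  subst (λ p → ∣ p ∣ ℚ.< _) (sym (ℚ.+-inverseʳ q)) 0<ε

fromℕ : ℕ → ℝ
fromℕ n = fromℚ (+ n ℚ./ 1)

_+_ : ℝ → ℝ → ℝ
x + y = mkℝ (λ n → seq x n ℚ.+ seq y n) cauchy
  where
  open +-*-Solver
  cauchy : IsCauchy (λ n → seq x n ℚ.+ seq y n)
  cauchy {ε} 0<ε with isCauchy x (*-pos 0<½ 0<ε) | isCauchy y (*-pos 0<½ 0<ε)
  ... | N₁ , x-close | N₂ , y-close = N₁ ℕ.⊔ N₂ , λ {m} {n} N≤m N≤n → begin-strict
    ∣ (seq x m ℚ.+ seq y m) ℚ.- (seq x n ℚ.+ seq y n) ∣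
      ≡⟨ cong ∣_∣ (difference-+ (seq x m) (seq y m) (seq x n) (seq y n)) ⟩
    ∣ (seq x m ℚ.- seq x n) ℚ.+ (seq y m ℚ.- seq y n) ∣
      ≤⟨ ℚ.∣p+q∣≤∣p∣+∣q∣ (seq x m ℚ.- seq x n) (seq y m ℚ.- seq y n) ⟩
    ∣ seq x m ℚ.- seq x n ∣ ℚ.+ ∣ seq y m ℚ.- seq y n ∣
      <⟨ ℚ.+-mono-<
           (x-close (ℕ.m⊔n≤o⇒m≤o N₁ N₂ N≤m) (ℕ.m⊔n≤o⇒m≤o N₁ N₂ N≤n))
           (y-close (ℕ.m⊔n≤o⇒n≤o N₁ N₂ N≤m) (ℕ.m⊔n≤o⇒n≤o N₁ N₂ N≤n)) ⟩
    ½ ℚ.* ε ℚ.+ ½ ℚ.* ε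
      ≡⟨ halves ε ⟩
    ε ∎
    where open ℚ.≤-Reasoning

-_ : ℝ → ℝ
- x = mkℝ (λ n → ℚ.- seq x n) cauchy
  where
  open +-*-Solver
  cauchy : IsCauchy (λ n → ℚ.- seq x n)
  cauchy {ε} 0<ε with isCauchy x 0<ε
  ... | N , close = N , λ {m} {n} N≤m N≤n → subst (λ p → ∣ p ∣ ℚ.< ε)
    (solve 2 (λ a b → b :+ (:- a) := (:- a) :+ (:- (:- b))) refl (seq x m) (seq x n))
    (close N≤n N≤m)

_-_ : ℝ → ℝ → ℝ
x - y = x + (- y)

eventually-bounded : ∀ x → ∃[ B ] 0ℚ ℚ.< B × ∃[ N ] ∀ {n} → N ℕ.≤ n → ∣ seq x n ∣ ℚ.≤ B
eventually-bounded x with isCauchy x 0<1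
... | N , close =
  1ℚ ℚ.+ ∣ seq x N ∣ ,
  ℚ.+-mono-<-≤ 0<1 (ℚ.0≤∣p∣ (seq x N)) ,
  N , λ {n} N≤n → begin
    ∣ seq x n ∣
      ≡⟨ cong ∣_∣ (solve 2 (λ a b → a := (a :+ (:- b)) :+ b) refl (seq x n) (seq x N)) ⟩
    ∣ (seq x n ℚ.- seq x N) ℚ.+ seq x N ∣
      ≤⟨ ℚ.∣p+q∣≤∣p∣+∣q∣ (seq x n ℚ.- seq x N) (seq x N) ⟩
    ∣ seq x n ℚ.- seq x N ∣ ℚ.+ ∣ seq x N ∣
      ≤⟨ ℚ.+-monoˡ-≤ ∣ seq x N ∣ (ℚ.<⇒≤ (close N≤n ℕ.≤-refl)) ⟩
    1ℚ ℚ.+ ∣ seq x N ∣ ∎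
  where
  open +-*-Solver
  open ℚ.≤-Reasoning

_*_ : ℝ → ℝ → ℝ
x * y = mkℝ (λ n → seq x n ℚ.* seq y n) cauchy
  where
  open +-*-Solver
  cauchy : IsCauchy (λ n → seq x n ℚ.* seq y n)
  cauchy {ε} 0<ε = N , close
    where
    x-bounded = eventually-bounded x
    y-bounded = eventually-bounded y
    A  = proj₁ x-bounded
    B  = proj₁ y-bounded
    Nᴬ = proj₁ (proj₂ (proj₂ x-bounded))
    Nᴮ = proj₁ (proj₂ (proj₂ y-bounded))

    0<A : 0ℚ ℚ.< A
    0<A = proj₁ (proj₂ x-bounded)
    0<B : 0ℚ ℚ.< B
    0<B = proj₁ (proj₂ y-bounded)

    split-A = divide-into 0<A (*-pos 0<½ 0<ε)
    split-B = divide-into 0<B (*-pos 0<½ 0<ε)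

    x-cauchy = isCauchy x (proj₁ (proj₂ split-B))
    y-cauchy = isCauchy y (proj₁ (proj₂ split-A))
    N₁ = proj₁ x-cauchy
    N₂ = proj₁ y-cauchy
    N  = (Nᴬ ℕ.⊔ Nᴮ) ℕ.⊔ (N₁ ℕ.⊔ N₂)

    close : ∀ {m n} → N ℕ.≤ m → N ℕ.≤ n →
            ∣ seq x m ℚ.* seq y m ℚ.- seq x n ℚ.* seq y n ∣ ℚ.< ε
    close {m} {n} N≤m N≤n = subst (_ ℚ.<_)
      (trans (cong₂ ℚ._+_ (proj₂ (proj₂ split-A)) (proj₂ (proj₂ split-B))) (halves ε))
      (∣-∣-difference-* (seq x m) (seq y m) (seq x n) (seq y n) 0<A 0<B
        (proj₂ (proj₂ (proj₂ x-bounded)) (ℕ.m⊔n≤o⇒m≤o Nᴬ Nᴮ (left N≤m)))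
        (proj₂ (proj₂ (proj₂ y-bounded)) (ℕ.m⊔n≤o⇒n≤o Nᴬ Nᴮ (left N≤n)))
        (proj₂ x-cauchy (ℕ.m⊔n≤o⇒m≤o N₁ N₂ (right N≤m)) (ℕ.m⊔n≤o⇒m≤o N₁ N₂ (right N≤n)))
        (proj₂ y-cauchy (ℕ.m⊔n≤o⇒n≤o N₁ N₂ (right N≤m)) (ℕ.m⊔n≤o⇒n≤o N₁ N₂ (right N≤n))))
      where
      left : ∀ {k} → N ℕ.≤ k → Nᴬ ℕ.⊔ Nᴮ ℕ.≤ k
      left = ℕ.m⊔n≤o⇒m≤o (Nᴬ ℕ.⊔ Nᴮ) (N₁ ℕ.⊔ N₂)
      right : ∀ {k} → N ℕ.≤ k → N₁ ℕ.⊔ N₂ ℕ.≤ k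
      right = ℕ.m⊔n≤o⇒n≤o (Nᴬ ℕ.⊔ Nᴮ) (N₁ ℕ.⊔ N₂)

inv : (x : ℝ) → {{NonZero x}} → ℝ
inv x {{x≢0}} = mkℝ (λ n → reciprocal (seq x n)) cauchy
  where
  open NonZero x≢0 renaming (bound to δ; bound-pos to 0<δ; index to N₁)
  open +-*-Solver
  cauchy : IsCauchy (λ n → reciprocal (seq x n))
  cauchy {ε} 0<ε with isCauchy x (*-pos 0<ε (*-pos 0<δ 0<δ))
  ... | N₂ , x-close = N₁ ℕ.⊔ N₂ , close
    where
    open ℚ.≤-Reasoning
    close : ∀ {m n} → N₁ ℕ.⊔ N₂ ℕ.≤ m → N₁ ℕ.⊔ N₂ ℕ.≤ n →
            ∣ reciprocal (seq x m) ℚ.- reciprocal (seq x n) ∣ ℚ.< ε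
    close {m} {n} N≤m N≤n = ℚ.*-cancelʳ-<-nonNeg ∣ a ℚ.* b ∣ {{ℚ.∣-∣-nonNeg (a ℚ.* b)}} (begin-strict
      ∣ a⁻¹ ℚ.- b⁻¹ ∣ ℚ.* ∣ a ℚ.* b ∣
        ≡⟨ ℚ.∣p*q∣≡∣p∣*∣q∣ (a⁻¹ ℚ.- b⁻¹) (a ℚ.* b) ⟨
      ∣ (a⁻¹ ℚ.- b⁻¹) ℚ.* (a ℚ.* b) ∣
        ≡⟨ cong ∣_∣ (difference-⁻¹ a b a⁻¹ b⁻¹) ⟩
      ∣ (a ℚ.* a⁻¹) ℚ.* b ℚ.- (b ℚ.* b⁻¹) ℚ.* a ∣
        ≡⟨ cong ∣_∣ (cong₂ ℚ._-_
             (trans (cong (ℚ._* b) (*-reciprocal (ℚ.<-≤-trans 0<δ δ≤a))) (ℚ.*-identityˡ b))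
             (trans (cong (ℚ._* a) (*-reciprocal (ℚ.<-≤-trans 0<δ δ≤b))) (ℚ.*-identityˡ a))) ⟩
      ∣ b ℚ.- a ∣
        <⟨ x-close (ℕ.m⊔n≤o⇒n≤o N₁ N₂ N≤n) (ℕ.m⊔n≤o⇒n≤o N₁ N₂ N≤m) ⟩
      ε ℚ.* (δ ℚ.* δ)
        ≤⟨ ℚ.*-monoˡ-≤-nonNeg ε {{ℚ.nonNegative (ℚ.<⇒≤ 0<ε)}}
             (*-mono-≤ (ℚ.<⇒≤ 0<δ) (ℚ.0≤∣p∣ b) δ≤a δ≤b) ⟩
      ε ℚ.* (∣ a ∣ ℚ.* ∣ b ∣)
        ≡⟨ cong (ε ℚ.*_) (ℚ.∣p*q∣≡∣p∣*∣q∣ a b) ⟨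
      ε ℚ.* ∣ a ℚ.* b ∣ ∎)
      where
      a = seq x m
      b = seq x n
      a⁻¹ = reciprocal a
      b⁻¹ = reciprocal b
      δ≤a : δ ℚ.≤ ∣ a ∣
      δ≤a = bounded (ℕ.m⊔n≤o⇒m≤o N₁ N₂ N≤m)
      δ≤b : δ ℚ.≤ ∣ b ∣
      δ≤b = bounded (ℕ.m⊔n≤o⇒m≤o N₁ N₂ N≤n)

_÷_ : (x y : ℝ) → {{NonZero y}} → ℝ
x ÷ y = x * inv y

1/_! : ℕ → ℚ
1/ j ! = (+ 1 ℚ./ (j !)) {{j ℕ.!≢0}}

exp-sum : ℕ → ℚ
exp-sum zero    = 0ℚ
exp-sum (suc n) = exp-sum n ℚ.+ 1/ n !

1/!-pos : ∀ n → 0ℚ ℚ.< 1/ n !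
1/!-pos n = /-mono-< 0 1 1 (n !) {{_}} {{n ℕ.!≢0}} z<s

exp-sum-mono : ∀ {m n} → m ℕ.≤ n → exp-sum m ℚ.≤ exp-sum n
exp-sum-mono m≤n = go (ℕ.≤⇒≤′ m≤n)
  where
  go : ∀ {m n} → m ℕ.≤′ n → exp-sum m ℚ.≤ exp-sum n
  go ℕ.≤′-refl             = ℚ.≤-refl
  go (ℕ.≤′-step {n} m≤n) = ℚ.≤-trans (go m≤n) (ℚ.≤-trans
    (ℚ.≤-reflexive (sym (ℚ.+-identityʳ (exp-sum n))))
    (ℚ.+-monoʳ-≤ (exp-sum n) (ℚ.<⇒≤ (1/!-pos n))))

exp-sum-upper : ∀ {m n} → 1 ℕ.≤ m → m ℕ.≤ n →
                exp-sum n ℚ.≤ exp-sum m ℚ.+ (1/ m ! ℚ.+ 1/ m !)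
exp-sum-upper {m} {n} 1≤m m≤n = begin
  exp-sum n                             ≡⟨ ℚ.+-identityʳ (exp-sum n) ⟨
  exp-sum n ℚ.+ 0ℚ                      ≤⟨ ℚ.+-monoʳ-≤ (exp-sum n) (ℚ.<⇒≤ (ℚ.+-mono-< (1/!-pos n) (1/!-pos n))) ⟩
  exp-sum n ℚ.+ (1/ n ! ℚ.+ 1/ n !)     ≤⟨ go (ℕ.≤⇒≤′ m≤n) ⟩
  exp-sum m ℚ.+ (1/ m ! ℚ.+ 1/ m !)     ∎
  where
  open ℚ.≤-Reasoning
  step : ∀ k → 1 ℕ.≤ k → 1/ suc k ! ℚ.+ 1/ suc k ! ℚ.≤ 1/ k !
  step k 1≤k = begin
    1/ suc k ! ℚ.+ 1/ suc k !
      ≡⟨ /-distrib-+ 1 1 (suc k !) {{suc k ℕ.!≢0}} ⟨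
    (+ 2 ℚ./ (suc k !)) {{suc k ℕ.!≢0}}
      ≤⟨ /-mono-≤ 2 (suc k !) 1 (k !) {{suc k ℕ.!≢0}} {{k ℕ.!≢0}}
           (ℕ.≤-trans (ℕ.*-monoˡ-≤ (k !) (s≤s 1≤k)) (ℕ.≤-reflexive (sym (ℕ.*-identityˡ (suc k !))))) ⟩
    1/ k ! ∎
  go : ∀ {n} → m ℕ.≤′ n → exp-sum n ℚ.+ (1/ n ! ℚ.+ 1/ n !) ℚ.≤ exp-sum m ℚ.+ (1/ m ! ℚ.+ 1/ m !)
  go ℕ.≤′-refl           = ℚ.≤-refl
  go (ℕ.≤′-step {n} m≤n) = begin
    (exp-sum n ℚ.+ 1/ n !) ℚ.+ (1/ suc n ! ℚ.+ 1/ suc n !)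
      ≤⟨ ℚ.+-monoʳ-≤ (exp-sum n ℚ.+ 1/ n !) (step n (ℕ.≤-trans 1≤m (ℕ.≤′⇒≤ m≤n))) ⟩
    (exp-sum n ℚ.+ 1/ n !) ℚ.+ 1/ n !
      ≡⟨ ℚ.+-assoc (exp-sum n) (1/ n !) (1/ n !) ⟩
    exp-sum n ℚ.+ (1/ n ! ℚ.+ 1/ n !)
      ≤⟨ go m≤n ⟩
    exp-sum m ℚ.+ (1/ m ! ℚ.+ 1/ m !) ∎

-- e = Σ 1/j!
e : ℝ
e = mkℝ exp-sum cauchy
  where
  n≤n! : ∀ n → n ℕ.≤ n !
  n≤n! zero    = z≤n
  n≤n! (suc n) = ℕ.m≤m*n (suc n) (n !) {{n ℕ.!≢0}}

  cauchy : IsCauchy exp-sum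
  cauchy {ε} 0<ε with archimedean (*-pos 0<½ 0<ε)
  ... | N , small = suc N , λ N≤m N≤n → ∣-∣-near (below N≤m N≤n) (below N≤n N≤m)
    where
    open ℚ.≤-Reasoning
    1/!-small : 1/ suc N ! ℚ.< ½ ℚ.* ε
    1/!-small = ℚ.≤-<-trans
      (/-mono-≤ 1 (suc N !) 1 (suc N) {{suc N ℕ.!≢0}} (ℕ.*-monoʳ-≤ 1 (n≤n! (suc N))))
      (small ℕ.≤-refl)
    below : ∀ {m n} → suc N ℕ.≤ m → suc N ℕ.≤ n → exp-sum m ℚ.< exp-sum n ℚ.+ ε
    below {m} {n} N≤m N≤n = begin-strict
      exp-sum m
        ≤⟨ exp-sum-upper (s≤s z≤n) N≤m ⟩
      exp-sum (suc N) ℚ.+ (1/ suc N ! ℚ.+ 1/ suc N !)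
        <⟨ ℚ.+-monoʳ-< (exp-sum (suc N)) (ℚ.+-mono-< 1/!-small 1/!-small) ⟩
      exp-sum (suc N) ℚ.+ (½ ℚ.* ε ℚ.+ ½ ℚ.* ε)
        ≡⟨ cong (exp-sum (suc N) ℚ.+_) (halves ε) ⟩
      exp-sum (suc N) ℚ.+ ε
        ≤⟨ ℚ.+-monoˡ-≤ ε (exp-sum-mono N≤n) ⟩
      exp-sum n ℚ.+ ε ∎

fromℕ-nonZero : ∀ n → NonZero (fromℕ (suc n))
fromℕ-nonZero n = record
  { bound     = 1ℚ
  ; bound-pos = 0<1
  ; index     = 0
  ; bounded   = λ _ → ℚ.≤-trans 1≤n (ℚ.≤-reflexive (sym (ℚ.0≤p⇒∣p∣≡p (ℚ.≤-trans 0≤1 1≤n))))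
  }
  where
  1≤n : 1ℚ ℚ.≤ + suc n ℚ./ 1
  1≤n = /-mono-≤ 1 1 (suc n) 1 (s≤s z≤n)

e-nonZero : NonZero e
e-nonZero = record
  { bound     = 1ℚ
  ; bound-pos = 0<1
  ; index     = 1
  ; bounded   = λ {n} 1≤n → ℚ.≤-trans (exp-sum-mono {1} {n} 1≤n)
      (ℚ.≤-reflexive (sym (ℚ.0≤p⇒∣p∣≡p (exp-sum-mono {0} {n} z≤n))))
  }

*-nonZero : ∀ {x y} → NonZero x → NonZero y → NonZero (x * y)
*-nonZero {x} {y} x≢0 y≢0 = record
  { bound     = X.bound ℚ.* Y.bound
  ; bound-pos = *-pos X.bound-pos Y.bound-pos
  ; index     = X.index ℕ.⊔ Y.index
  ; bounded   = λ {n} N≤n → ℚ.≤-trans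
      (*-mono-≤ (ℚ.<⇒≤ X.bound-pos) (ℚ.0≤∣p∣ (seq y n))
        (X.bounded (ℕ.m⊔n≤o⇒m≤o X.index Y.index N≤n))
        (Y.bounded (ℕ.m⊔n≤o⇒n≤o X.index Y.index N≤n)))
      (ℚ.≤-reflexive (sym (ℚ.∣p*q∣≡∣p∣*∣q∣ (seq x n) (seq y n))))
  }
  where
  module X = NonZero x≢0
  module Y = NonZero y≢0

instance
  4e-nonZero : NonZero (fromℕ 4 * e)
  4e-nonZero = *-nonZero {fromℕ 4} {e} (fromℕ-nonZero 3) e-nonZero

largest≤ : (d n b : ℕ) → ℕ
largest≤ d n zero    = 0
largest≤ d n (suc b) with suc b ℕ.^ d ℕ.≤? n
... | yes _ = suc b
... | no  _ = largest≤ d n b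

-- ⌊ n^(1/d) ⌋ for d ≥ 1.
floorRoot : (d n : ℕ) → ℕ
floorRoot d n = largest≤ d n n

floorRoot-lower : ∀ d n .{{_ : ℕ.NonZero d}} → floorRoot d n ℕ.^ d ℕ.≤ n
floorRoot-lower d@(suc _) n = go n
  where
  go : ∀ b → largest≤ d n b ℕ.^ d ℕ.≤ n
  go zero    = z≤n
  go (suc b) with suc b ℕ.^ d ℕ.≤? n
  ... | yes b^d≤n = b^d≤n
  ... | no  _     = go b

floorRoot-upper : ∀ d n .{{_ : ℕ.NonZero d}} → n ℕ.< suc (floorRoot d n) ℕ.^ d
floorRoot-upper d n = ℕ.≰⇒> λ r^d≤n →
  ℕ.<-irrefl refl (go n (ℕ.≤-trans (m≤m^d (suc (floorRoot d n)) d) r^d≤n) r^d≤n)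
  where
  m≤m^d : ∀ m d .{{_ : ℕ.NonZero d}} → m ℕ.≤ m ℕ.^ d
  m≤m^d zero    d       = z≤n
  m≤m^d (suc m) (suc d) = ℕ.m≤m*n (suc m) (suc m ℕ.^ d) {{ℕ.m^n≢0 (suc m) d}}
  go : ∀ {m} b → m ℕ.≤ b → m ℕ.^ d ℕ.≤ n → m ℕ.≤ largest≤ d n b
  go zero    m≤0 _ = m≤0
  go (suc b) m≤b m^d≤n with suc b ℕ.^ d ℕ.≤? n | ℕ.m≤n⇒m<n∨m≡n m≤b
  ... | yes _     | _                = m≤b
  ... | no _      | inj₁ (s≤s m≤b′) = go b m≤b′ m^d≤n
  ... | no b^d≰n  | inj₂ refl        = ⊥-elim (b^d≰n m^d≤n)

-- The real number n^(1/d): its k-th approximation r satisfies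
-- r ≤ n^(1/d) < r + 1/(k+1).
root : (d n : ℕ) .{{_ : ℕ.NonZero d}} → ℝ
root d n = mkℝ approx cauchy
  where
  numer : ℕ → ℕ
  numer k = floorRoot d (n ℕ.* suc k ℕ.^ d)

  approx : ℕ → ℚ
  approx k = + numer k ℚ./ suc k

  ^-distrib-* : ∀ a b d → (a ℕ.* b) ℕ.^ d ≡ a ℕ.^ d ℕ.* b ℕ.^ d
  ^-distrib-* a b zero    = refl
  ^-distrib-* a b (suc d) = trans (cong (a ℕ.* b ℕ.*_) (^-distrib-* a b d))
    (ℕ.[m*n]*[o*p]≡[m*o]*[n*p] a b (a ℕ.^ d) (b ℕ.^ d))

  cross : ∀ k l → numer k ℕ.* suc l ℕ.< suc (numer l) ℕ.* suc k
  cross k l = ℕ.≰⇒> λ le → ℕ.<-irrefl refl (begin-strict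
    (n ℕ.* suc l ℕ.^ d) ℕ.* suc k ℕ.^ d
      <⟨ ℕ.*-monoˡ-< (suc k ℕ.^ d) {{ℕ.m^n≢0 (suc k) d}} (floorRoot-upper d (n ℕ.* suc l ℕ.^ d)) ⟩
    suc (numer l) ℕ.^ d ℕ.* suc k ℕ.^ d
      ≡⟨ ^-distrib-* (suc (numer l)) (suc k) d ⟨
    (suc (numer l) ℕ.* suc k) ℕ.^ d
      ≤⟨ ℕ.^-monoˡ-≤ d le ⟩
    (numer k ℕ.* suc l) ℕ.^ d
      ≡⟨ ^-distrib-* (numer k) (suc l) d ⟩
    numer k ℕ.^ d ℕ.* suc l ℕ.^ d
      ≤⟨ ℕ.*-monoˡ-≤ (suc l ℕ.^ d) (floorRoot-lower d (n ℕ.* suc k ℕ.^ d)) ⟩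
    (n ℕ.* suc k ℕ.^ d) ℕ.* suc l ℕ.^ d
      ≡⟨ ℕ.*-assoc n _ _ ⟩
    n ℕ.* (suc k ℕ.^ d ℕ.* suc l ℕ.^ d)
      ≡⟨ cong (n ℕ.*_) (ℕ.*-comm (suc k ℕ.^ d) _) ⟩
    n ℕ.* (suc l ℕ.^ d ℕ.* suc k ℕ.^ d)
      ≡⟨ ℕ.*-assoc n _ _ ⟨
    (n ℕ.* suc l ℕ.^ d) ℕ.* suc k ℕ.^ d ∎)
    where open ℕ.≤-Reasoning

  cauchy : IsCauchy approx
  cauchy {ε} 0<ε with archimedean 0<ε
  ... | N , small = N , λ {k} {l} N≤k N≤l → ∣-∣-near (below k l N≤l) (below l k N≤k)
    where
    open ℚ.≤-Reasoning
    below : ∀ k l → N ℕ.≤ l → approx k ℚ.< approx l ℚ.+ ε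
    below k l N≤l = begin-strict
      approx k                    <⟨ /-mono-< (numer k) (suc k) (suc (numer l)) (suc l) (cross k l) ⟩
      + (1 ℕ.+ numer l) ℚ./ suc l ≡⟨ cong (λ m → + m ℚ./ suc l) (ℕ.+-comm 1 (numer l)) ⟩
      + (numer l ℕ.+ 1) ℚ./ suc l ≡⟨ /-distrib-+ (numer l) 1 (suc l) ⟩
      approx l ℚ.+ + 1 ℚ./ suc l  <⟨ ℚ.+-monoʳ-< (approx l) (small N≤l) ⟩
      approx l ℚ.+ ε              ∎

-- ⊤⁺ plays the role of infinity.
open AddSupremum ℕ._≤_ public using () renaming (_≤⁺_ to _≤ℕ⁺_)
open AddSupremum _≤_   public using () renaming (_≤⁺_ to _≤ℝ⁺_)

fromℕ⁺ : ℕ ⁺ → ℝ ⁺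
fromℕ⁺ [ n ] = [ fromℕ n ]
fromℕ⁺ ⊤⁺    = ⊤⁺

private
  variable
    c ℓ : Level

-- A directed graph given by its adjacency matrix; loops and multiple
-- edges are allowed.
record Digraph (c ℓ : Level) : Set (Level.suc (c ⊔ ℓ)) where
  field
    vertices : Setoid c ℓ

  open Setoid vertices public renaming (Carrier to Vertex) using (_≈_)

  field
    adjacency      : Vertex → Vertex → ℕ
    adjacency-cong : ∀ {x x′ y y′} → x ≈ x′ → y ≈ y′ → adjacency x y ≡ adjacency x′ y′

  Edge : Vertex → Vertex → Set
  Edge x y = 0 ℕ.< adjacency x y

  data Walk : ℕ → Vertex → Vertex → Set (c ⊔ ℓ) where
    here : ∀ {x y} → x ≈ y → Walk 0 x y
    step : ∀ {n x y z} → Edge x y → Walk n y z → Walk (suc n) x z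

  -- A shortest walk is automatically a path.
  IsDistance : Vertex → Vertex → ℕ ⁺ → Set (c ⊔ ℓ)
  IsDistance x y [ n ] = Walk n x y × (∀ m → Walk m x y → n ℕ.≤ m)
  IsDistance x y ⊤⁺    = ∀ m → ¬ Walk m x y

  IsUpperBound : ℕ ⁺ → Set (c ⊔ ℓ)
  IsUpperBound D = ∀ x y δ → IsDistance x y δ → δ ≤ℕ⁺ D

  IsDiameter : ℕ ⁺ → Set (c ⊔ ℓ)
  IsDiameter D = IsUpperBound D × (∀ U → IsUpperBound U → D ≤ℕ⁺ U)

  IsUndirected : Set c
  IsUndirected = ∀ x y → adjacency x y ≡ adjacency y x

module _ (V : Setoid c ℓ) where
  private module V = Setoid V

  -- One edge from x to out x i for each i.
  outDigraph : Decidable V._≈_ → ∀ {d} (out : V.Carrier → Fin d → V.Carrier) →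
               (∀ {x x′} i → x V.≈ x′ → out x i V.≈ out x′ i) → Digraph c ℓ
  outDigraph _≟_ {d} out out-cong = record
    { vertices       = V
    ; adjacency      = λ x y → length (filter (λ i → out x i ≟ y) (allFin d))
    ; adjacency-cong = λ {x} {x′} {y} {y′} x≈x′ y≈y′ → cong length
        (filter-≐ (λ i → out x i ≟ y) (λ i → out x′ i ≟ y′)
          ( (λ {i} p → V.trans (V.sym (out-cong i x≈x′)) (V.trans p y≈y′))
          , (λ {i} p → V.trans (out-cong i x≈x′) (V.trans p (V.sym y≈y′))))
          (allFin d))
    }

record FiniteAbelianGroup (c ℓ : Level) : Set (Level.suc (c ⊔ ℓ)) where
  field
    abelianGroup : AbelianGroup c ℓ

  open AbelianGroup abelianGroup public

  field
    order       : ℕ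
    enumeration : Inverse setoid (≡.setoid (Fin order))

  _≟_ : Decidable _≈_
  _≟_ = via-injection (Inverse⇒Injection enumeration) Fin._≟_

module _ (G : FiniteAbelianGroup c ℓ) where
  open FiniteAbelianGroup G

  record Automorphism : Set (c ⊔ ℓ) where
    open GroupMorphisms rawGroup rawGroup using (IsGroupIsomorphism)
    field
      apply               : Carrier → Carrier
      isGroupIsomorphism  : IsGroupIsomorphism apply

    open IsGroupIsomorphism isGroupIsomorphism public using (⟦⟧-cong)

  record HasOrderTwo (σ : Automorphism) : Set (c ⊔ ℓ) where
    open Automorphism σ
    field
      involutive  : ∀ x → apply (apply x) ≈ x
      nonidentity : ¬ (∀ x → apply x ≈ x)

  -- A finite subset is presented by listing its elements without
  -- repetition.
  record FiniteSubset : Set (c ⊔ ℓ) where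
    field
      size    : ℕ
      listing : Injection (≡.setoid (Fin size)) setoid

    open Injection listing public using () renaming (to to element)

    Member : Carrier → Set ℓ
    Member x = ∃[ i ] element i ≈ x

  IsSymmetric : FiniteSubset → Set (c ⊔ ℓ)
  IsSymmetric S = ∀ x → Member x → Member (x ⁻¹)
    where open FiniteSubset S

  module _ (S : FiniteSubset) where
    open FiniteSubset S

    cayleySumGraph : Digraph c ℓ
    cayleySumGraph = outDigraph setoid _≟_ (λ x i → x ⁻¹ ∙ element i)
      (λ _ x≈x′ → ∙-congʳ (⁻¹-cong x≈x′))

    module _ (σ : Automorphism) where
      open Automorphism σ

      twistedCayleyGraph : Digraph c ℓ
      twistedCayleyGraph = outDigraph setoid _≟_ (λ x i → apply (x ∙ element i))
        (λ _ x≈x′ → ⟦⟧-cong (∙-congʳ x≈x′))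

      twistedCayleySumGraph : Digraph c ℓ
      twistedCayleySumGraph = outDigraph setoid _≟_ (λ x i → apply (x ⁻¹ ∙ element i))
        (λ _ x≈x′ → ⟦⟧-cong (∙-congʳ (⁻¹-cong x≈x′)))

{-# OPTIONS --safe #-}

-- Undirectedness of the twisted graphs forces σ(S) = S. As S is also
-- symmetric, a vertex at distance at most k from ε is then a product of
-- at most k elements of S, so that a graph of diameter k satisfies
-- n ≤ C(k + d, d) ≤ (k + d)^d / d!. With d^d ≤ 4^d d! this
-- gives d n^(1/d) ≤ 4 (k + d) ≤ 8 (k + d/2) ≤ 4e (k + d/2).
module Submission where

open import Defs
open import Data.Empty using (⊥-elim)
open import Data.Fin.Base using (Fin; zero; suc)
open import Data.Fin.Properties using (injective⇒≤)
open import Data.Integer.Base using (+_)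
import Data.Integer.Properties as ℤ
open import Data.List.Base using (List; []; _∷_; _++_; map; length; filter; allFin)
import Data.List.Membership.Setoid as SetoidMembership
import Data.List.Membership.Setoid.Properties as Membership
open import Data.List.Membership.Propositional using (_∈_)
open import Data.List.Membership.Propositional.Properties using (∈-allFin; ∈-filter⁻)
open import Data.List.Properties using (length-++; length-map; filter-some)
open import Data.List.Relation.Unary.Any using (here; any?; index)
import Data.List.Relation.Unary.Any as Any
open import Data.Nat.Base as ℕ using (ℕ; zero; suc; _!; z≤n; s≤s; ⌊_/2⌋; ⌈_/2⌉)
open import Data.Nat.Induction using (<-rec)
import Data.Nat.Properties as ℕ
open import Data.Nat.Solver using () renaming (module +-*-Solver to ℕ-Solver)
open import Data.Product.Base using (∃-syntax; _,_; proj₁; proj₂)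
open import Data.Rational.Base as ℚ using (0ℚ; 1ℚ; ½)
import Data.Rational.Properties as ℚ
open import Data.Rational.Solver using (module +-*-Solver)
import Data.Rational.Unnormalised.Base as ℚᵘ
import Data.Rational.Unnormalised.Properties as ℚᵘ
open import Data.Sum.Base using (_⊎_; inj₁; inj₂)
open import Function.Base using (_∘_)
open import Function.Bundles using (Inverse)
open import Level using (Level; _⊔_)
open import Relation.Binary.Construct.Add.Supremum.NonStrict using ([_]; _≤⊤⁺)
open import Relation.Binary.PropositionalEquality.Core
  using (_≡_; refl; sym; trans; cong; cong₂; subst)
open import Relation.Nullary.Construct.Add.Supremum using (_⁺; [_]; ⊤⁺)
open import Relation.Nullary.Decidable.Core using (yes; no)
open import Relation.Nullary.Negation.Core using (¬_)
open import Relation.Unary using (Pred; Decidable)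

private
  variable
    c ℓ ℓ′ : Level

-- Inequalities between powers and factorials

^-distribʳ-* : ∀ a b d → (a ℕ.* b) ℕ.^ d ≡ a ℕ.^ d ℕ.* b ℕ.^ d
^-distribʳ-* a b zero    = refl
^-distribʳ-* a b (suc d) = trans (cong (a ℕ.* b ℕ.*_) (^-distribʳ-* a b d))
  (ℕ.[m*n]*[o*p]≡[m*o]*[n*p] a b (a ℕ.^ d) (b ℕ.^ d))

^-cancelʳ-≤ : ∀ d {m n} .{{_ : ℕ.NonZero d}} → m ℕ.^ d ℕ.≤ n ℕ.^ d → m ℕ.≤ n
^-cancelʳ-≤ d m^d≤n^d = ℕ.≮⇒≥ λ n<m →
  ℕ.<-irrefl refl (ℕ.<-≤-trans (ℕ.^-monoˡ-< d n<m) m^d≤n^d)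

n!≤n^n : ∀ n → n ! ℕ.≤ n ℕ.^ n
n!≤n^n zero    = ℕ.≤-refl
n!≤n^n (suc n) = ℕ.*-monoʳ-≤ (suc n)
  (ℕ.≤-trans (n!≤n^n n) (ℕ.^-monoˡ-≤ n (ℕ.n≤1+n n)))

-- The left side consists of the first two terms of the binomial expansion of the right side. It
-- matches Pascal's rule in the count of monomials.
suc-^-lower : ∀ n d → n ℕ.^ suc d ℕ.+ suc d ℕ.* n ℕ.^ d ℕ.≤ suc n ℕ.^ suc d
suc-^-lower n zero    = ℕ.≤-reflexive
  (solve 1 (λ n → n :* con 1 :+ con 1 := (con 1 :+ n) :* con 1) refl n)
  where open ℕ-Solver
suc-^-lower n (suc d) = begin
  n ℕ.* (n ℕ.* m) ℕ.+ suc (suc d) ℕ.* (n ℕ.* m)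
    ≤⟨ ℕ.m≤m+n _ (suc d ℕ.* m) ⟩
  n ℕ.* (n ℕ.* m) ℕ.+ suc (suc d) ℕ.* (n ℕ.* m) ℕ.+ suc d ℕ.* m
    ≡⟨ solve 3 (λ n d m →
         n :* (n :* m) :+ (con 2 :+ d) :* (n :* m) :+ (con 1 :+ d) :* m
         := (con 1 :+ n) :* (n :* m :+ (con 1 :+ d) :* m)) refl n d m ⟩
  suc n ℕ.* (n ℕ.* m ℕ.+ suc d ℕ.* m)
    ≤⟨ ℕ.*-monoʳ-≤ (suc n) (suc-^-lower n d) ⟩
  suc n ℕ.^ suc (suc d) ∎
  where
  open ℕ.≤-Reasoning
  open ℕ-Solver
  m = n ℕ.^ d

-- Bernoulli's inequality (1 - 1/(m+1))^k ≥ 1 - k/(m+1), multiplied out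
-- so that no subtraction occurs.
suc-^-upper : ∀ m k →
  suc m ℕ.^ k ℕ.* suc m ℕ.≤ m ℕ.^ k ℕ.* suc m ℕ.+ k ℕ.* suc m ℕ.^ k
suc-^-upper m zero    = ℕ.m≤m+n _ 0
suc-^-upper m (suc k) = begin
  suc m ℕ.* x ℕ.* suc m
    ≡⟨ solve 2 (λ m x → (con 1 :+ m) :* x :* (con 1 :+ m)
         := m :* (x :* (con 1 :+ m)) :+ x :* (con 1 :+ m)) refl m x ⟩
  m ℕ.* (x ℕ.* suc m) ℕ.+ x ℕ.* suc m
    ≤⟨ ℕ.+-monoˡ-≤ _ (ℕ.*-monoʳ-≤ m (suc-^-upper m k)) ⟩
  m ℕ.* (y ℕ.* suc m ℕ.+ k ℕ.* x) ℕ.+ x ℕ.* suc m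
    ≤⟨ ℕ.m≤m+n _ (k ℕ.* x) ⟩
  m ℕ.* (y ℕ.* suc m ℕ.+ k ℕ.* x) ℕ.+ x ℕ.* suc m ℕ.+ k ℕ.* x
    ≡⟨ solve 4 (λ m k x y →
         m :* (y :* (con 1 :+ m) :+ k :* x) :+ x :* (con 1 :+ m) :+ k :* x
         := m :* y :* (con 1 :+ m) :+ (con 1 :+ k) :* ((con 1 :+ m) :* x)) refl m k x y ⟩
  m ℕ.* y ℕ.* suc m ℕ.+ suc k ℕ.* (suc m ℕ.* x) ∎
  where
  open ℕ.≤-Reasoning
  open ℕ-Solver
  x = suc m ℕ.^ k
  y = m ℕ.^ k

-- For k at most half of m + 1, the loss k/(m+1) in Bernoulli's inequality is at most 1/2. Two
-- copies of that inequality are added so that the loss becomes one copy of `x * suc m`, which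
-- cancels.
suc-^-≤-double : ∀ {m k} → k ℕ.+ k ℕ.≤ suc m → suc m ℕ.^ k ℕ.≤ 2 ℕ.* m ℕ.^ k
suc-^-≤-double {m} {k} 2k≤1+m = ℕ.*-cancelʳ-≤ x (2 ℕ.* y) (suc m)
  (ℕ.+-cancelʳ-≤ (x ℕ.* suc m) (x ℕ.* suc m) (2 ℕ.* y ℕ.* suc m) (begin
    x ℕ.* suc m ℕ.+ x ℕ.* suc m
      ≤⟨ ℕ.+-mono-≤ (suc-^-upper m k) (suc-^-upper m k) ⟩
    (y ℕ.* suc m ℕ.+ k ℕ.* x) ℕ.+ (y ℕ.* suc m ℕ.+ k ℕ.* x)
      ≡⟨ solve 4 (λ m k x y → (y :* m :+ k :* x) :+ (y :* m :+ k :* x)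
           := con 2 :* y :* m :+ x :* (k :+ k)) refl (suc m) k x y ⟩
    2 ℕ.* y ℕ.* suc m ℕ.+ x ℕ.* (k ℕ.+ k)
      ≤⟨ ℕ.+-monoʳ-≤ _ (ℕ.*-monoʳ-≤ x 2k≤1+m) ⟩
    2 ℕ.* y ℕ.* suc m ℕ.+ x ℕ.* suc m ∎))
  where
  open ℕ.≤-Reasoning
  open ℕ-Solver
  x = suc m ℕ.^ k
  y = m ℕ.^ k

-- Splitting the exponent into halves keeps Bernoulli's inequality
-- useful for each factor.
suc-^-≤-quadruple : ∀ m → suc m ℕ.^ m ℕ.≤ 4 ℕ.* m ℕ.^ m
suc-^-≤-quadruple m = begin
  suc m ℕ.^ m
    ≡⟨ cong (suc m ℕ.^_) (ℕ.⌊n/2⌋+⌈n/2⌉≡n m) ⟨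
  suc m ℕ.^ (a ℕ.+ b)
    ≡⟨ ℕ.^-distribˡ-+-* (suc m) a b ⟩
  suc m ℕ.^ a ℕ.* suc m ℕ.^ b
    ≤⟨ ℕ.*-mono-≤ (suc-^-≤-double {m} {a} 2a≤1+m) (suc-^-≤-double {m} {b} 2b≤1+m) ⟩
  (2 ℕ.* m ℕ.^ a) ℕ.* (2 ℕ.* m ℕ.^ b)
    ≡⟨ ℕ.[m*n]*[o*p]≡[m*o]*[n*p] 2 (m ℕ.^ a) 2 (m ℕ.^ b) ⟩
  4 ℕ.* (m ℕ.^ a ℕ.* m ℕ.^ b)
    ≡⟨ cong (4 ℕ.*_) (ℕ.^-distribˡ-+-* m a b) ⟨
  4 ℕ.* m ℕ.^ (a ℕ.+ b)
    ≡⟨ cong (λ k → 4 ℕ.* m ℕ.^ k) (ℕ.⌊n/2⌋+⌈n/2⌉≡n m) ⟩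
  4 ℕ.* m ℕ.^ m ∎
  where
  open ℕ.≤-Reasoning
  a = ⌊ m /2⌋
  b = ⌈ m /2⌉
  -- Since ⌈m/2⌉ is by definition ⌊(m+1)/2⌋, it is the smaller half of `suc m`.
  2b≤1+m : b ℕ.+ b ℕ.≤ suc m
  2b≤1+m = ℕ.≤-trans (ℕ.+-monoʳ-≤ b (ℕ.⌊n/2⌋≤⌈n/2⌉ (suc m)))
    (ℕ.≤-reflexive (ℕ.⌊n/2⌋+⌈n/2⌉≡n (suc m)))
  2a≤1+m : a ℕ.+ a ℕ.≤ suc m
  2a≤1+m = ℕ.≤-trans (ℕ.+-mono-≤ (ℕ.⌊n/2⌋≤⌈n/2⌉ m) (ℕ.⌊n/2⌋≤⌈n/2⌉ m)) 2b≤1+m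

-- From n to n + 1 the quotient n^n / n! grows by the factor (n+1)^n / n^n, which is at most 4.
n^n≤4^n*n! : ∀ n → n ℕ.^ n ℕ.≤ 4 ℕ.^ n ℕ.* n !
n^n≤4^n*n! zero    = ℕ.≤-refl
n^n≤4^n*n! (suc n) = begin
  suc n ℕ.* suc n ℕ.^ n
    ≤⟨ ℕ.*-monoʳ-≤ (suc n) (suc-^-≤-quadruple n) ⟩
  suc n ℕ.* (4 ℕ.* n ℕ.^ n)
    ≤⟨ ℕ.*-monoʳ-≤ (suc n) (ℕ.*-monoʳ-≤ 4 (n^n≤4^n*n! n)) ⟩
  suc n ℕ.* (4 ℕ.* (4 ℕ.^ n ℕ.* n !))
    ≡⟨ solve 3 (λ s x f → s :* (con 4 :* (x :* f)) := con 4 :* x :* (s :* f))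
         refl (suc n) (4 ℕ.^ n) (n !) ⟩
  4 ℕ.^ suc n ℕ.* suc n ! ∎
  where
  open ℕ.≤-Reasoning
  open ℕ-Solver

-- From integer bounds to the real root

-- The hypothesis is n^(1/d) ≤ b/d in integers. With s = k + 1, `floorRoot d (n * s ^ d)` is the
-- numerator of the k-th approximation in `root`, and comparing d-th powers carries the bound over
-- to it.
floorRoot-bound : ∀ d n s b .{{_ : ℕ.NonZero d}} →
  n ℕ.* d ℕ.^ d ℕ.≤ b ℕ.^ d → d ℕ.* floorRoot d (n ℕ.* s ℕ.^ d) ℕ.≤ b ℕ.* s
floorRoot-bound d n s b n*d^d≤b^d = ^-cancelʳ-≤ d (begin
  (d ℕ.* r) ℕ.^ d
    ≡⟨ ^-distribʳ-* d r d ⟩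
  d ℕ.^ d ℕ.* r ℕ.^ d
    ≤⟨ ℕ.*-monoʳ-≤ (d ℕ.^ d) (floorRoot-lower d (n ℕ.* s ℕ.^ d)) ⟩
  d ℕ.^ d ℕ.* (n ℕ.* s ℕ.^ d)
    ≡⟨ solve 3 (λ x n y → x :* (n :* y) := n :* x :* y) refl (d ℕ.^ d) n (s ℕ.^ d) ⟩
  n ℕ.* d ℕ.^ d ℕ.* s ℕ.^ d
    ≤⟨ ℕ.*-monoˡ-≤ (s ℕ.^ d) n*d^d≤b^d ⟩
  b ℕ.^ d ℕ.* s ℕ.^ d
    ≡⟨ ^-distribʳ-* b s d ⟨
  (b ℕ.* s) ℕ.^ d ∎)
  where
  open ℕ.≤-Reasoning
  open ℕ-Solver
  r = floorRoot d (n ℕ.* s ℕ.^ d)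

*-/-assoc : ∀ m n s .{{_ : ℕ.NonZero s}} →
            (+ m ℚ./ 1) ℚ.* (+ n ℚ./ s) ≡ + (m ℕ.* n) ℚ./ s
*-/-assoc m n (suc s) = ℚ.toℚᵘ-injective (begin
  ℚ.toℚᵘ ((+ m ℚ./ 1) ℚ.* (+ n ℚ./ suc s))
    ≈⟨ ℚ.toℚᵘ-homo-* (+ m ℚ./ 1) (+ n ℚ./ suc s) ⟩
  ℚ.toℚᵘ (+ m ℚ./ 1) ℚᵘ.* ℚ.toℚᵘ (+ n ℚ./ suc s)
    ≈⟨ ℚᵘ.*-cong (ℚ.toℚᵘ-fromℚᵘ (ℚᵘ.mkℚᵘ (+ m) 0)) (ℚ.toℚᵘ-fromℚᵘ (ℚᵘ.mkℚᵘ (+ n) s)) ⟩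
  ℚᵘ.mkℚᵘ (+ m) 0 ℚᵘ.* ℚᵘ.mkℚᵘ (+ n) s
    ≡⟨ cong₂ ℚᵘ.mkℚᵘ (sym (ℤ.pos-* m n)) (ℕ.+-identityʳ s) ⟩
  ℚᵘ.mkℚᵘ (+ (m ℕ.* n)) s
    ≈⟨ ℚ.toℚᵘ-fromℚᵘ (ℚᵘ.mkℚᵘ (+ (m ℕ.* n)) s) ⟨
  ℚ.toℚᵘ (+ (m ℕ.* n) ℚ./ suc s) ∎)
  where open import Relation.Binary.Reasoning.Setoid ℚᵘ.≃-setoid

-- Clears the denominator that `÷` hides in `reciprocal`: multiplying by p > 0 reduces the goal to
-- the hypothesis.
*-reciprocal-≤ : ∀ {a b p} q → 0ℚ ℚ.< p → a ℚ.* q ℚ.≤ b ℚ.* p →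
                 (a ℚ.* reciprocal p) ℚ.* q ℚ.≤ b
*-reciprocal-≤ {a} {b} {p} q 0<p aq≤bp =
  ℚ.*-cancelʳ-≤-pos p {{ℚ.positive 0<p}} (begin
    (a ℚ.* reciprocal p) ℚ.* q ℚ.* p
      ≡⟨ solve 4 (λ a r q p → a :* r :* q :* p := a :* q :* (p :* r)) refl a (reciprocal p) q p ⟩
    a ℚ.* q ℚ.* (p ℚ.* reciprocal p)
      ≡⟨ cong (a ℚ.* q ℚ.*_) (*-reciprocal
           (subst (0ℚ ℚ.<_) (sym (ℚ.0≤p⇒∣p∣≡p (ℚ.<⇒≤ 0<p))) 0<p)) ⟩
    a ℚ.* q ℚ.* 1ℚ
      ≡⟨ ℚ.*-identityʳ (a ℚ.* q) ⟩
    a ℚ.* q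
      ≤⟨ aq≤bp ⟩
    b ℚ.* p ∎)
  where
  open ℚ.≤-Reasoning
  open +-*-Solver

-- Checked term by term on the approximating sequences. The bound 2 on the partial sums of e
-- suffices, since e enters as a divisor.
root-bound : ∀ d n k .{{_ : ℕ.NonZero d}} →
  n ℕ.* d ℕ.^ d ℕ.≤ (4 ℕ.* (k ℕ.+ d)) ℕ.^ d →
  (fromℕ d ÷ (fromℕ 4 * e)) * root d n - fromℚ ½ * fromℕ d ≤ fromℕ k
-- From index 2 on, `exp-sum` is at least 1/0! + 1/1! = 2.
root-bound d n k n*d^d≤ {ε} 0<ε = 2 , bound
  where
  open ℚ.≤-Reasoning
  open +-*-Solver
  module N = ℕ-Solver

  d′ = + d ℚ./ 1
  k′ = + k ℚ./ 1

  0≤/1 : ∀ m → 0ℚ ℚ.≤ + m ℚ./ 1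
  0≤/1 m = /-mono-≤ 0 1 m 1 z≤n

  -- The target after d/2 has been moved to the right side.
  h = k′ ℚ.+ ½ ℚ.* d′

  0≤h : 0ℚ ℚ.≤ h
  0≤h = ℚ.+-mono-≤ (0≤/1 k) (subst (ℚ._≤ ½ ℚ.* d′) (ℚ.*-zeroʳ ½)
    (ℚ.*-monoˡ-≤-nonNeg ½ (0≤/1 d)))

  bound : ∀ {m} → 2 ℕ.≤ m →
          seq ((fromℕ d ÷ (fromℕ 4 * e)) * root d n - fromℚ ½ * fromℕ d) m ℚ.≤ k′ ℚ.+ ε
  bound {m} 2≤m = begin
    (d′ ℚ.* reciprocal p) ℚ.* q ℚ.- ½ ℚ.* d′
      ≤⟨ ℚ.+-monoˡ-≤ (ℚ.- (½ ℚ.* d′)) (*-reciprocal-≤ {d′} {h} {p} q 0<p d′q≤hp) ⟩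
    h ℚ.- ½ ℚ.* d′
      ≡⟨ solve 2 (λ k x → k :+ x :+ (:- x) := k :+ con 0ℚ) refl k′ (½ ℚ.* d′) ⟩
    k′ ℚ.+ 0ℚ
      ≤⟨ ℚ.+-monoʳ-≤ k′ (ℚ.<⇒≤ 0<ε) ⟩
    k′ ℚ.+ ε ∎
    where
    p = (+ 4 ℚ./ 1) ℚ.* exp-sum m
    r = floorRoot d (n ℕ.* suc m ℕ.^ d)
    q = + r ℚ./ suc m

    8≤p : + 8 ℚ./ 1 ℚ.≤ p
    8≤p = ℚ.*-monoˡ-≤-nonNeg (+ 4 ℚ./ 1) (exp-sum-mono 2≤m)

    0<p : 0ℚ ℚ.< p
    0<p = ℚ.<-≤-trans (ℚ.positive⁻¹ (+ 8 ℚ./ 1)) 8≤p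

    -- Adding 4k turns 4(k + d) into 8k + 4d = 8h, to be compared with `h * p` by way of 8 ≤ p.
    d*r≤ : d ℕ.* r ℕ.≤ (8 ℕ.* k ℕ.+ 4 ℕ.* d) ℕ.* suc m
    d*r≤ = ℕ.≤-trans (floorRoot-bound d n (suc m) (4 ℕ.* (k ℕ.+ d)) n*d^d≤)
      (ℕ.*-monoˡ-≤ (suc m) (ℕ.≤-trans (ℕ.m≤m+n (4 ℕ.* (k ℕ.+ d)) (4 ℕ.* k))
        (ℕ.≤-reflexive (N.solve 2 (λ k d →
          N.con 4 N.:* (k N.:+ d) N.:+ N.con 4 N.:* k
          N.:= N.con 8 N.:* k N.:+ N.con 4 N.:* d) refl k d))))

    d′q≤hp : d′ ℚ.* q ℚ.≤ h ℚ.* p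
    d′q≤hp = begin
      d′ ℚ.* q
        ≡⟨ *-/-assoc d r (suc m) ⟩
      + (d ℕ.* r) ℚ./ suc m
        ≤⟨ /-mono-≤ (d ℕ.* r) (suc m) (8 ℕ.* k ℕ.+ 4 ℕ.* d) 1
             (ℕ.≤-trans (ℕ.≤-reflexive (ℕ.*-identityʳ (d ℕ.* r))) d*r≤) ⟩
      + (8 ℕ.* k ℕ.+ 4 ℕ.* d) ℚ./ 1
        ≡⟨ /-distrib-+ (8 ℕ.* k) (4 ℕ.* d) 1 ⟩
      + (8 ℕ.* k) ℚ./ 1 ℚ.+ + (4 ℕ.* d) ℚ./ 1
        ≡⟨ cong₂ ℚ._+_ (*-/-assoc 8 k 1) (*-/-assoc 4 d 1) ⟨
      (+ 8 ℚ./ 1) ℚ.* k′ ℚ.+ (+ 4 ℚ./ 1) ℚ.* d′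
        ≡⟨ solve 2 (λ k d → con (+ 8 ℚ./ 1) :* k :+ con (+ 4 ℚ./ 1) :* d
             := (k :+ con ½ :* d) :* con (+ 8 ℚ./ 1)) refl k′ d′ ⟩
      h ℚ.* (+ 8 ℚ./ 1)
        ≤⟨ ℚ.*-monoˡ-≤-nonNeg h {{ℚ.nonNegative 0≤h}} 8≤p ⟩
      h ℚ.* p ∎

-- Positive adjacency entries

module _ {d} {P : Pred (Fin d) ℓ′} (P? : Decidable P) where

  filter-allFin-nonempty : ∀ i → P i → 0 ℕ.< length (filter P? (allFin d))
  filter-allFin-nonempty i Pi =
    filter-some P? (Any.map (λ { refl → Pi }) (∈-allFin i))

  filter-allFin-witness : 0 ℕ.< length (filter P? (allFin d)) → ∃[ i ] P i
  filter-allFin-witness 0<l with i ∷ _ ← filter P? (allFin d) in eq =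
    i , proj₂ (∈-filter⁻ P? {xs = allFin d} (subst (i ∈_) (sym eq) (here refl)))

-- Counting monomials in a finite abelian group

module _ (G : FiniteAbelianGroup c ℓ) where
  open FiniteAbelianGroup G hiding (refl; sym; trans; _-_)
  private module G = FiniteAbelianGroup G
  open SetoidMembership setoid using () renaming (_∈_ to _∈G_)
  open import Algebra.Properties.Group group using (ε⁻¹≈ε; ⁻¹-involutive; inverseʳ-unique)
  open import Algebra.Properties.AbelianGroup abelianGroup using (⁻¹-∙-comm)
  open import Algebra.Properties.CommutativeSemigroup commutativeSemigroup using (x∙yz≈y∙xz)

  -- Monomials of degree at most k in s₀, …, s_{d-1}, each exponent
  -- vector listed once; hence there are C(k + d, d) of them.
  monomials : ∀ {d} → (Fin d → Carrier) → ℕ → List Carrier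
  monomials {zero}  s k       = ε ∷ []
  monomials {suc d} s zero    = ε ∷ []
  monomials {suc d} s (suc k) =
    monomials (s ∘ suc) (suc k) ++ map (s zero ∙_) (monomials s k)

  -- Induction along the split in `monomials`: either the first generator is absent, or one factor
  -- of it is removed. For `suc d` generators and degree `suc k`, both induction hypotheses have
  -- base k + d + 1, and `suc-^-lower` bounds their combination.
  length-monomials : ∀ {d} (s : Fin d → Carrier) k →
                     d ! ℕ.* length (monomials s k) ℕ.≤ (k ℕ.+ d) ℕ.^ d
  length-monomials {zero}  s k       = ℕ.≤-refl
  length-monomials {suc d} s zero    =
    ℕ.≤-trans (ℕ.≤-reflexive (ℕ.*-identityʳ (suc d !))) (n!≤n^n (suc d))
  length-monomials {suc d} s (suc k) = begin
    suc d ! ℕ.* length (monomials (s ∘ suc) (suc k) ++ map (s zero ∙_) (monomials s k))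
      ≡⟨ cong (suc d ! ℕ.*_) (trans (length-++ (monomials (s ∘ suc) (suc k)))
           (cong (l ℕ.+_) (length-map (s zero ∙_) (monomials s k)))) ⟩
    suc d ! ℕ.* (l ℕ.+ l′)
      ≡⟨ solve 4 (λ d f l m → (con 1 :+ d) :* f :* (l :+ m)
           := (con 1 :+ d) :* f :* m :+ (con 1 :+ d) :* (f :* l)) refl d (d !) l l′ ⟩
    suc d ! ℕ.* l′ ℕ.+ suc d ℕ.* (d ! ℕ.* l)
      ≤⟨ ℕ.+-mono-≤ (length-monomials s k)
           (ℕ.*-monoʳ-≤ (suc d) (length-monomials (s ∘ suc) (suc k))) ⟩
    (k ℕ.+ suc d) ℕ.^ suc d ℕ.+ suc d ℕ.* (suc k ℕ.+ d) ℕ.^ d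
      ≡⟨ cong (λ m → (k ℕ.+ suc d) ℕ.^ suc d ℕ.+ suc d ℕ.* m ℕ.^ d) (ℕ.+-suc k d) ⟨
    (k ℕ.+ suc d) ℕ.^ suc d ℕ.+ suc d ℕ.* (k ℕ.+ suc d) ℕ.^ d
      ≤⟨ suc-^-lower (k ℕ.+ suc d) d ⟩
    (suc k ℕ.+ suc d) ℕ.^ suc d ∎
    where
    open ℕ.≤-Reasoning
    open ℕ-Solver
    l  = length (monomials (s ∘ suc) (suc k))
    l′ = length (monomials s k)

  ε∈monomials : ∀ {d} (s : Fin d → Carrier) k → ε ∈G monomials s k
  ε∈monomials {zero}  s k       = here G.refl
  ε∈monomials {suc d} s zero    = here G.refl
  ε∈monomials {suc d} s (suc k) =
    Membership.∈-++⁺ˡ setoid (ε∈monomials (s ∘ suc) (suc k))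

  ∈-resp-≈ : ∀ {xs x y} → x ≈ y → x ∈G xs → y ∈G xs
  ∈-resp-≈ = Membership.∈-resp-≈ setoid

  ∙-∈-map : ∀ a {x xs} → x ∈G xs → (a ∙ x) ∈G map (a ∙_) xs
  ∙-∈-map a = Membership.∈-map⁺ setoid setoid ∙-congˡ

  -- The new factor is inserted at its place by recursion through the generators. Where x already
  -- contains the first generator, commutativity moves the new factor past it.
  ∙-∈-monomials : ∀ {d} (s : Fin d → Carrier) k i {x} →
                  x ∈G monomials s k → (s i ∙ x) ∈G monomials s (suc k)
  ∙-∈-monomials s k zero x∈ =
    Membership.∈-++⁺ʳ setoid (monomials (s ∘ suc) (suc k)) (∙-∈-map (s zero) x∈)
  -- In degree 0 only ε is listed, and for a generator other than the first the product belongs to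
  -- the part without `s zero`.
  ∙-∈-monomials s zero (suc i) (here x≈ε) =
    Membership.∈-++⁺ˡ setoid (∈-resp-≈ (∙-congˡ (G.sym x≈ε))
      (∙-∈-monomials (s ∘ suc) 0 i (ε∈monomials (s ∘ suc) 0)))
  ∙-∈-monomials s (suc k) (suc i) x∈
    with Membership.∈-++⁻ setoid (monomials (s ∘ suc) (suc k)) x∈
  ... | inj₁ x∈ˡ = Membership.∈-++⁺ˡ setoid (∙-∈-monomials (s ∘ suc) (suc k) i x∈ˡ)
  ... | inj₂ x∈ʳ with Membership.∈-map⁻ setoid setoid x∈ʳ
  ...   | y , y∈ , x≈s₀y = Membership.∈-++⁺ʳ setoid (monomials (s ∘ suc) (suc (suc k)))
    (∈-resp-≈ (G.trans (x∙yz≈y∙xz (s zero) (s (suc i)) y) (∙-congˡ (G.sym x≈s₀y)))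
      (∙-∈-map (s zero) (∙-∈-monomials s k (suc i) y∈)))

  -- Choosing for each element a position in `xs` is injective, because elements found at the same
  -- position are equal.
  order≤length : ∀ xs → (∀ x → x ∈G xs) → order ℕ.≤ length xs
  order≤length xs covers = injective⇒≤ {f = λ i → index (covers (E.from i))} λ {i} {j} eq →
    trans (sym (E.inverseˡ G.refl))
      (trans (E.to-cong (Membership.index-injective setoid (covers (E.from i)) (covers (E.from j)) eq))
        (E.inverseˡ G.refl))
    where module E = Inverse enumeration

  -- Products of at most k elements of S

  module _ (S : FiniteSubset G) (S-symmetric : IsSymmetric G S) where
    open FiniteSubset S renaming (size to d)

    -- `empty` is available at every k, so that the index bounds the length of the word. Words,
    -- unlike membership in `monomials`, are carried factor by factor along an endomorphism.
    data Product : ℕ → Carrier → Set (c ⊔ ℓ) where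
      empty  : ∀ {k x} → x ≈ ε → Product k x
      factor : ∀ {k x y} i → x ≈ element i ∙ y → Product k y → Product (suc k) x

    Product-resp : ∀ {k x y} → x ≈ y → Product k x → Product k y
    Product-resp x≈y (empty x≈ε)      = empty (G.trans (G.sym x≈y) x≈ε)
    Product-resp x≈y (factor i x≈sz q) = factor i (G.trans (G.sym x≈y) x≈sz) q

    Product-mono : ∀ {j k x} → j ℕ.≤ k → Product j x → Product k x
    Product-mono _         (empty x≈ε)       = empty x≈ε
    Product-mono (s≤s j≤k) (factor i x≈sy q) = factor i x≈sy (Product-mono j≤k q)

    Product-∙ʳ : ∀ {k x} i → Product k x → Product (suc k) (x ∙ element i)
    Product-∙ʳ i = factor i (comm _ (element i))

    -- Stated for general f because it serves twice: for inversion, an endomorphism as the group is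
    -- abelian, and for σ.
    Product-map : (f : Carrier → Carrier) → (∀ {x y} → x ≈ y → f x ≈ f y) →
                  (∀ x y → f (x ∙ y) ≈ f x ∙ f y) → f ε ≈ ε →
                  (∀ i → Member (f (element i))) →
                  ∀ {k x} → Product k x → Product k (f x)
    Product-map f f-cong f-∙ f-ε f-S = go
      where
      go : ∀ {k x} → Product k x → Product k (f x)
      go (empty x≈ε) = empty (G.trans (f-cong x≈ε) f-ε)
      go (factor {y = y} i x≈sy q) = factor (proj₁ (f-S i))
        (G.trans (f-cong x≈sy) (G.trans (f-∙ (element i) y) (∙-congʳ (G.sym (proj₂ (f-S i))))))
        (go q)

    Product-⁻¹ : ∀ {k x} → Product k x → Product k (x ⁻¹)
    Product-⁻¹ = Product-map _⁻¹ ⁻¹-cong (λ x y → G.sym (⁻¹-∙-comm x y)) ε⁻¹≈ε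
      (λ i → S-symmetric (element i) (i , G.refl))

    Product⇒∈monomials : ∀ {k x} → Product k x → x ∈G monomials element k
    Product⇒∈monomials (empty x≈ε) = ∈-resp-≈ (G.sym x≈ε) (ε∈monomials element _)
    Product⇒∈monomials (factor {k} i x≈sy q) =
      ∈-resp-≈ (G.sym x≈sy) (∙-∈-monomials element k i (Product⇒∈monomials q))

    -- Walks and diameters

    module _ (out : Carrier → Fin d → Carrier)
             (out-cong : ∀ {x x′} i → x ≈ x′ → out x i ≈ out x′ i) where

      private
        X = outDigraph setoid G._≟_ out out-cong
      open Digraph X using (Edge; Walk; here; step; IsUpperBound; IsUndirected)

      out-edge : ∀ x i → Edge x (out x i)
      out-edge x i = filter-allFin-nonempty (λ j → out x j G.≟ out x i) i G.refl

      edge-out : ∀ x y → Edge x y → ∃[ i ] out x i ≈ y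
      edge-out x y = filter-allFin-witness (λ j → out x j G.≟ y)

      -- Supplies the way back along an edge, from which both twisted cases read off that σ maps S
      -- into itself.
      out-reversible : IsUndirected → ∀ x i → ∃[ j ] out (out x i) j ≈ x
      out-reversible undirected x i = edge-out (out x i) x
        (subst (0 ℕ.<_) (undirected x (out x i)) (out-edge x i))

      module _ (out-Product : ∀ {k x} i → Product k x → Product (suc k) (out x i)) where

        walk-Product : ∀ {k m x y} → Walk m x y → Product k x → Product (m ℕ.+ k) y
        walk-Product (here x≈y) q = Product-resp x≈y q
        walk-Product {k} {suc m} {x} {z} (step {y = y} edge walk) q with edge-out x y edge
        ... | i , out≈y = subst (λ j → Product j z) (ℕ.+-suc m k)
          (walk-Product walk (Product-resp out≈y (out-Product i q)))

        -- The bound speaks only of distances, and no distance is at hand for an arbitrary y.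
        -- Membership in the finite list is decidable; if it fails, y turns out to be unreachable,
        -- so its distance is infinite and exceeds k.
        upperBound⇒covers : ∀ {k} → IsUpperBound [ k ] → ∀ y → y ∈G monomials element k
        upperBound⇒covers {k} bounded y with any? (y G.≟_) (monomials element k)
        ... | yes y∈ = y∈
        ... | no  y∉ = ⊥-elim (absurd (bounded ε y ⊤⁺ unreachable))
          where
          absurd : ¬ (⊤⁺ ≤ℕ⁺ [ k ])
          absurd ()
          near : ∀ {m} → [ m ] ≤ℕ⁺ [ k ] → m ℕ.≤ k
          near [ m≤k ] = m≤k
          unreachable : ∀ m → ¬ Walk m ε y
          -- With shorter walks excluded, a walk of length m is a shortest one, so m is a distance
          -- and at most k. Then y would be a product of at most k elements after all.
          unreachable = <-rec (λ m → ¬ Walk m ε y) λ m shorter walk →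
            y∉ (Product⇒∈monomials (Product-mono
              (ℕ.≤-trans (ℕ.≤-reflexive (ℕ.+-identityʳ m))
                (near (bounded ε y [ m ] (walk , λ l walk′ → ℕ.≮⇒≥ λ l<m → shorter l<m walk′))))
              (walk-Product walk (empty {0} G.refl))))

        -- This is d n^(1/d) ≤ 4 (k + d) without roots. The d! from `n^n≤4^n*n!` is the one that
        -- `length-monomials` absorbs.
        upperBound⇒order : ∀ {k} → IsUpperBound [ k ] →
                           order ℕ.* d ℕ.^ d ℕ.≤ (4 ℕ.* (k ℕ.+ d)) ℕ.^ d
        upperBound⇒order {k} bounded = begin
          order ℕ.* d ℕ.^ d
            ≤⟨ ℕ.*-mono-≤ (order≤length (monomials element k) (upperBound⇒covers bounded))
                 (n^n≤4^n*n! d) ⟩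
          l ℕ.* (4 ℕ.^ d ℕ.* d !)
            ≡⟨ solve 3 (λ l x f → l :* (x :* f) := x :* (f :* l)) refl l (4 ℕ.^ d) (d !) ⟩
          4 ℕ.^ d ℕ.* (d ! ℕ.* l)
            ≤⟨ ℕ.*-monoʳ-≤ (4 ℕ.^ d) (length-monomials element k) ⟩
          4 ℕ.^ d ℕ.* (k ℕ.+ d) ℕ.^ d
            ≡⟨ ^-distribʳ-* 4 (k ℕ.+ d) d ⟨
          (4 ℕ.* (k ℕ.+ d)) ℕ.^ d ∎
          where
          open ℕ.≤-Reasoning
          open ℕ-Solver
          l = length (monomials element k)

    -- The steps of the three graphs

    sumStep : Carrier → Fin d → Carrier
    sumStep x i = x ⁻¹ ∙ element i

    sumStep-cong : ∀ {x x′} i → x ≈ x′ → sumStep x i ≈ sumStep x′ i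
    sumStep-cong _ x≈x′ = ∙-congʳ (⁻¹-cong x≈x′)

    -- Since S is symmetric, `x ⁻¹` needs no more factors than x, so only the new element adds one.
    Product-sumStep : ∀ {k x} i → Product k x → Product (suc k) (sumStep x i)
    Product-sumStep i q = Product-∙ʳ i (Product-⁻¹ q)

    module _ (σ : Automorphism G) (σ-order-two : HasOrderTwo G σ) where
      open Automorphism σ
      open HasOrderTwo σ-order-two using (involutive)
      open import Algebra.Morphism.Structures using (module GroupMorphisms)
      open GroupMorphisms rawGroup rawGroup using (module IsGroupIsomorphism; module IsGroupHomomorphism)
      open IsGroupIsomorphism isGroupIsomorphism using (isGroupHomomorphism)
      open IsGroupHomomorphism isGroupHomomorphism using (homo; ε-homo)

      -- Applying σ again undoes it and fixes ε. This strips the outer σ from the equation of a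
      -- two-edge walk back to ε.
      apply-≈ε : ∀ {x} → apply x ≈ ε → x ≈ ε
      apply-≈ε {x} σx≈ε = G.trans (G.sym (involutive x)) (G.trans (⟦⟧-cong σx≈ε) ε-homo)

      Product-apply : (∀ i → Member (apply (element i))) →
                      ∀ {k x} → Product k x → Product k (apply x)
      Product-apply = Product-map apply ⟦⟧-cong homo ε-homo

      twistedStep : Carrier → Fin d → Carrier
      twistedStep x i = apply (x ∙ element i)

      twistedStep-cong : ∀ {x x′} i → x ≈ x′ → twistedStep x i ≈ twistedStep x′ i
      twistedStep-cong _ x≈x′ = ⟦⟧-cong (∙-congʳ x≈x′)

      twistedSumStep : Carrier → Fin d → Carrier
      twistedSumStep x i = apply (sumStep x i)

      twistedSumStep-cong : ∀ {x x′} i → x ≈ x′ → twistedSumStep x i ≈ twistedSumStep x′ i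
      twistedSumStep-cong i x≈x′ = ⟦⟧-cong (sumStep-cong i x≈x′)

      -- An edge from σ(s) back to ε by way of t ∈ S means t = σ(s)⁻¹.
      twisted-closed : Digraph.IsUndirected (twistedCayleyGraph G S σ) →
                       ∀ i → Member (apply (element i))
      twisted-closed undirected i
        with j , eq ← out-reversible twistedStep twistedStep-cong undirected ε i
        with j′ , t≈ ← S-symmetric (element j) (j , G.refl)
        = j′ , G.trans t≈ (G.trans (⁻¹-cong
            (inverseʳ-unique (twistedStep ε i) (element j) (apply-≈ε eq)))
            (G.trans (⁻¹-involutive (twistedStep ε i)) (⟦⟧-cong (identityˡ (element i)))))

      -- Here such an edge means t = σ(s).
      twistedSum-closed : Digraph.IsUndirected (twistedCayleySumGraph G S σ) →
                          ∀ i → Member (apply (element i))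
      twistedSum-closed undirected i
        with j , eq ← out-reversible twistedSumStep twistedSumStep-cong undirected ε i
        = j , G.trans
            (inverseʳ-unique (twistedSumStep ε i ⁻¹) (element j) (apply-≈ε eq))
            (G.trans (⁻¹-involutive (twistedSumStep ε i))
              (⟦⟧-cong (G.trans (∙-congʳ ε⁻¹≈ε) (identityˡ (element i)))))

      -- σ acts on the whole product, but it sends each factor back into S and so leaves their
      -- number unchanged.
      Product-twistedStep : Digraph.IsUndirected (twistedCayleyGraph G S σ) →
                            ∀ {k x} i → Product k x → Product (suc k) (twistedStep x i)
      Product-twistedStep undirected i q =
        Product-apply (twisted-closed undirected) (Product-∙ʳ i q)

      Product-twistedSumStep : Digraph.IsUndirected (twistedCayleySumGraph G S σ) →
                               ∀ {k x} i → Product k x → Product (suc k) (twistedSumStep x i)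
      Product-twistedSumStep undirected i q =
        Product-apply (twistedSum-closed undirected) (Product-sumStep i q)

-- Diameter bounds for the three graphs

upperBound⇒order-bound :
  ∀ (G : FiniteAbelianGroup c ℓ) (σ : Automorphism G) → HasOrderTwo G σ →
  (S : FiniteSubset G) → IsSymmetric G S → (X : Digraph c ℓ) →
  X ≡ cayleySumGraph G S ⊎ X ≡ twistedCayleyGraph G S σ ⊎ X ≡ twistedCayleySumGraph G S σ →
  Digraph.IsUndirected X → ∀ {k} → Digraph.IsUpperBound X [ k ] →
  let n = FiniteAbelianGroup.order G
      d = FiniteSubset.size S in
  n ℕ.* d ℕ.^ d ℕ.≤ (4 ℕ.* (k ℕ.+ d)) ℕ.^ d
-- `cayleySumGraph` unfolds to `outDigraph` applied to `sumStep` and `sumStep-cong`, so the general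
-- bound applies as it stands; likewise for the twisted graphs.
upperBound⇒order-bound G _ _ S S-symmetric _ (inj₁ refl) _ =
  upperBound⇒order G S S-symmetric
    (sumStep G S S-symmetric) (sumStep-cong G S S-symmetric)
    (Product-sumStep G S S-symmetric)
upperBound⇒order-bound G σ σ² S S-symmetric _ (inj₂ (inj₁ refl)) undirected =
  upperBound⇒order G S S-symmetric
    (twistedStep G S S-symmetric σ σ²) (twistedStep-cong G S S-symmetric σ σ²)
    (Product-twistedStep G S S-symmetric σ σ² undirected)
upperBound⇒order-bound G σ σ² S S-symmetric _ (inj₂ (inj₂ refl)) undirected =
  upperBound⇒order G S S-symmetric
    (twistedSumStep G S S-symmetric σ σ²) (twistedSumStep-cong G S S-symmetric σ σ²)
    (Product-twistedSumStep G S S-symmetric σ σ² undirected)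

theorem9p1 : ∀ {c ℓ} (G : FiniteAbelianGroup c ℓ) → 4 ℕ.≤ FiniteAbelianGroup.order G →
    (σ : Automorphism G) → HasOrderTwo G σ →
    (S : FiniteSubset G) → IsSymmetric G S →
    (X : Digraph c ℓ) →
    X ≡ cayleySumGraph G S ⊎ X ≡ twistedCayleyGraph G S σ ⊎ X ≡ twistedCayleySumGraph G S σ →
    Digraph.IsUndirected X →
    let n = FiniteAbelianGroup.order G
        d = FiniteSubset.size S in
    .{{_ : ℕ.NonZero d}} →
    (D : ℕ ⁺) → Digraph.IsDiameter X D →
    [ (fromℕ d ÷ (fromℕ 4 * e)) * root d n - fromℚ ½ * fromℕ d ] ≤ℝ⁺ fromℕ⁺ D
theorem9p1 G _ σ σ² S S-symmetric X X≡ undirected [ k ] (bounded , _) =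
  [ root-bound (FiniteSubset.size S) (FiniteAbelianGroup.order G) k
      (upperBound⇒order-bound G σ σ² S S-symmetric X X≡ undirected bounded) ]
-- An infinite diameter lies above every real number.
theorem9p1 _ _ _ _ _ _ _ _ _ ⊤⁺ _ = _ ≤⊤⁺
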